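{- Let $D$ be a partial layer decomposition (PLD) of a DAG $G=(V,A)$. Let $X$ be a root variable of $G$ (a variable with no parents in $G$) such that $X$ is a boundary variable of $\mathrm{Vars}(D)$. For a PLD $D'$ of $G$, define $w(D')$ to be the width of an optimal (minimum-width) layer decomposition $D''$ of $G$ such that $D'$ is a sub-PLD of $D''$ (with $w(D')=\infty$ if no such $D''$ exists). Then $w(D')$ is the same for every insertion $D'$ of $X$ into $D$.
   Context: All graphs are finite. A layer decomposition of a DAG $G=(V,A)$ is a list $((T^0,S^0),\dots,(T^k,S^k))$ of pairs of subsets of $V$ such that: (D1) $(T^0,\dots,T^k)$ is an ordered partition of $V$ (into nonempty blocks); (D2) $S^i\subseteq T^i$ for every $i\in\{0,\dots,k\}$; (D3) for every $i\in\{0,\dots,k-1\}$, no two variables $X\in T^0\cup\dots\cup T^{i-1}\cup(T^i\setminus S^i)$ and $Y\in T^{i+1}\cup\dots\cup T^k$ are connected by an arrow in $G$; (D4) for every $i\in\{1,\dots,k\}$, every child in $G$ of a variable in $S^i$ belongs to $(T^i\setminus S^i)\cup S^{i-1}$, and every child of a variable in $S^0$ belongs to $T^0\setminus S^0$; (D5) for every $i\in\{0,\dots,k-1\}$, every parent in $G$ of a variable in $S^i$ belongs to $T^{i+1}$, and no variable in $S^k$ has a parent. The width of a layer decomposition is the lowest integer $w$ such that $|T^i|\le w$ for every $i\in\{0,\dots,k\}$. For $W\subseteq V$, $G[W]$ is the subgraph of $G$ induced on $W$. A partial layer decomposition (PLD) $D$ of $G$ is a layer decomposition of $G[W]$ for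 some $W\subseteq V$; then $\mathrm{Vars}(D)=W$. In particular, a layer decomposition of $G$ is a PLD with $\mathrm{Vars}(D)=V$. Let $D=((T_1^0,S_1^0),\dots,(T_1^k,S_1^k))$ and $D'=((T_2^0,S_2^0),\dots,(T_2^j,S_2^j))$ be PLDs of $G$ with $\mathrm{Vars}(D')\subseteq\mathrm{Vars}(D)$. $D'$ is a sub-PLD of $D$ iff there is a non-negative integer $m$ such that for all $i\in\{0,\dots,j\}$: $T_2^i\subseteq T_1^{i+m}$, $S_2^i\subseteq S_1^{i+m}$ and $T_2^i\setminus S_2^i\subseteq T_1^{i+m}\setminus S_1^{i+m}$. For a PLD $D$ of $G$ and $X\in V\setminus\mathrm{Vars}(D)$, an insertion of $X$ into $D$ is a PLD $D'$ of $G$ with $\mathrm{Vars}(D')=\mathrm{Vars}(D)\cup\{X\}$ such that $D$ is a sub-PLD of $D'$. For $W\subseteq V$, a boundary variable of $W$ is a variable $X\in V\setminus W$ such that some parent or child of $X$ in $G$ belongs to $W$. -}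

module Defs where

open import Data.Fin using (Fin; zero; suc; inject₁; fromℕ; fromℕ<; toℕ) renaming (_<_ to _<ᶠ_)
open import Data.Fin.Properties using (all?; any?; injective⇒≤; toℕ<n; toℕ-fromℕ<)
  renaming (_≟_ to _≟ᶠ_; _<?_ to _<ᶠ?_)
open import Data.Fin.Subset using (Subset; _∈_; _∉_; _⊆_; _∪_; _─_; ⁅_⁆; ∣_∣; Nonempty)
open import Data.Fin.Subset.Properties using (_∈?_; _⊆?_; nonempty?; anySubset?)
open import Data.Nat using (ℕ; zero; suc; _+_; _≤_; _<_; _⊔_; z≤n)
open import Data.Nat.Induction using (<-wellFounded)
open import Data.Nat.Properties
  using (≤-trans; m≤m⊔n; m≤n⊔m; ⊔-lub; ≮⇒≥; _<?_)
  renaming (_≟_ to _≟ᴺ_)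
open import Data.Product using (∃; ∃-syntax; _×_; _,_; proj₁; proj₂)
open import Data.Sum using (_⊎_; inj₁; inj₂)
open import Data.Vec using (Vec; []; _∷_; lookup; map; foldr′)
open import Induction.WellFounded using (Acc; acc)
open import Level using (0ℓ)
open import Relation.Binary using (Rel; Decidable)
open import Relation.Binary.Construct.Closure.Transitive
  using (TransClosure; _∷_) renaming ([_] to [_]₁)
open import Relation.Binary.PropositionalEquality using (_≡_; sym; subst)
open import Relation.Nullary using (¬_; Dec; yes; no)
open import Relation.Nullary.Construct.Add.Supremum using (_⁺; ⊤⁺) renaming ([_] to [_]⁺)
open import Relation.Nullary.Decidable using (map′; ¬?; _×-dec_; _⊎-dec_; _→-dec_)
import Relation.Unary as U

private
  variable
    n k j : ℕ

-- The vertices form a subset of a fixed finite universe Fin n, so that an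
-- induced subgraph lives in the same universe as the graph itself.
record DAG (n : ℕ) : Set₁ where
  field
    vertices : Subset n
    _⟶_      : Rel (Fin n) 0ℓ
    _⟶?_     : Decidable _⟶_
    source   : ∀ {x y} → x ⟶ y → x ∈ vertices
    target   : ∀ {x y} → x ⟶ y → y ∈ vertices
    acyclic  : ∀ {x} → ¬ TransClosure _⟶_ x x

open DAG using (vertices)

infix 8 _[_]

_[_] : DAG n → Subset n → DAG n
_[_] {n} G W = record
  { vertices = W
  ; _⟶_      = _⟶ᵂ_
  ; _⟶?_     = λ x y → (x ⟶? y) ×-dec (x ∈? W) ×-dec (y ∈? W)
  ; source   = λ (_ , x∈W , _) → x∈W
  ; target   = λ (_ , _ , y∈W) → y∈W
  ; acyclic  = λ c → acyclic (forget c)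
  }
  where
  open DAG G using (_⟶_; _⟶?_; acyclic)

  _⟶ᵂ_ : Rel (Fin n) 0ℓ
  x ⟶ᵂ y = x ⟶ y × x ∈ W × y ∈ W

  forget : ∀ {x y} → TransClosure _⟶ᵂ_ x y → TransClosure _⟶_ x y
  forget [ (e , _) ]₁  = [ e ]₁
  forget ((e , _) ∷ p) = e ∷ forget p

Root : DAG n → Fin n → Set
Root G x = x ∈ vertices G × (∀ y → ¬ y ⟶ x)
  where open DAG G using (_⟶_)

Boundary : DAG n → Subset n → Fin n → Set
Boundary G W x =
  x ∈ vertices G × x ∉ W × ∃[ y ] y ∈ W × (y ⟶ x ⊎ x ⟶ y)
  where open DAG G using (_⟶_)

-- The index k is the number of the last layer: (T⁰ , S⁰) ∷ … ∷ (Tᵏ , Sᵏ) ∷ []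
Layers : ℕ → ℕ → Set
Layers n k = Vec (Subset n × Subset n) (suc k)

T S : Layers n k → Fin (suc k) → Subset n
T L i = proj₁ (lookup L i)
S L i = proj₂ (lookup L i)

-- An index i : Fin k ranges over {0,…,k-1}: the layers with numbers i and
-- i + 1 are then those at positions inject₁ i and suc i.
record IsLayerDecomposition (G : DAG n) (L : Layers n k) : Set where
  open DAG G using (_⟶_)
  field
    D1-nonempty : ∀ i → Nonempty (T L i)
    D1-disjoint : ∀ i j x → x ∈ T L i → x ∈ T L j → i ≡ j
    D1-⊆        : ∀ i → T L i ⊆ vertices G
    D1-cover    : ∀ x → x ∈ vertices G → ∃[ i ] x ∈ T L i
    D2          : ∀ i → S L i ⊆ T L i
    D3          : ∀ (i : Fin k) x y →
                  (∃[ h ] h <ᶠ inject₁ i × x ∈ T L h) ⊎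
                    x ∈ T L (inject₁ i) ─ S L (inject₁ i) →
                  (∃[ j ] inject₁ i <ᶠ j × y ∈ T L j) →
                  ¬ (x ⟶ y ⊎ y ⟶ x)
    D4-suc      : ∀ (i : Fin k) x y → x ∈ S L (suc i) → x ⟶ y →
                  y ∈ (T L (suc i) ─ S L (suc i)) ∪ S L (inject₁ i)
    D4-zero     : ∀ x y → x ∈ S L zero → x ⟶ y → y ∈ T L zero ─ S L zero
    D5-below    : ∀ (i : Fin k) x y → x ∈ S L (inject₁ i) → y ⟶ x →
                  y ∈ T L (suc i)
    D5-last     : ∀ x y → x ∈ S L (fromℕ k) → ¬ y ⟶ x

maxSize : ∀ {m} → Vec (Subset n × Subset n) m → ℕ
maxSize L = foldr′ _⊔_ 0 (map (λ (Tⁱ , _) → ∣ Tⁱ ∣) L)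

record LayerDecomposition (G : DAG n) : Set where
  field
    {last}               : ℕ
    layers               : Layers n last
    isLayerDecomposition : IsLayerDecomposition G layers

  width : ℕ
  width = maxSize layers

open LayerDecomposition using (width)

width-upper : ∀ {G : DAG n} (D : LayerDecomposition G) →
              ∀ i → ∣ T (LayerDecomposition.layers D) i ∣ ≤ width D
width-upper D = go (LayerDecomposition.layers D)
  where
  go : ∀ {m} (L : Vec (Subset n × Subset n) m) i →
       ∣ proj₁ (lookup L i) ∣ ≤ maxSize L
  go (_ ∷ L) zero    = m≤m⊔n _ _
  go (_ ∷ L) (suc i) = ≤-trans (go L i) (m≤n⊔m _ _)

width-least : ∀ {G : DAG n} (D : LayerDecomposition G) →
              ∀ {v} → (∀ i → ∣ T (LayerDecomposition.layers D) i ∣ ≤ v) → width D ≤ v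
width-least D {v} = go (LayerDecomposition.layers D)
  where
  go : ∀ {m} (L : Vec (Subset n × Subset n) m) →
       (∀ i → ∣ proj₁ (lookup L i) ∣ ≤ v) →
       maxSize L ≤ v
  go []      _ = z≤n
  go (_ ∷ L) h = ⊔-lub (h zero) (go L (λ i → h (suc i)))

record PLD (G : DAG n) : Set where
  field
    Vars          : Subset n
    Vars⊆V        : Vars ⊆ vertices G
    decomposition : LayerDecomposition (G [ Vars ])

  open LayerDecomposition decomposition public using (last; layers)

open PLD using (Vars; layers)

toPLD : {G : DAG n} → LayerDecomposition G → PLD G
toPLD {G = G} D = record
  { Vars          = vertices G
  ; Vars⊆V        = λ x∈V → x∈V
  ; decomposition = record
    { layers               = LayerDecomposition.layers D
    ; isLayerDecomposition = record
      { D1-nonempty = D1-nonempty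
      ; D1-disjoint = D1-disjoint
      ; D1-⊆        = D1-⊆
      ; D1-cover    = D1-cover
      ; D2          = D2
      ; D3          = λ { i x y p q (inj₁ (e , _)) → D3 i x y p q (inj₁ e)
                        ; i x y p q (inj₂ (e , _)) → D3 i x y p q (inj₂ e) }
      ; D4-suc      = λ i x y p (e , _) → D4-suc i x y p e
      ; D4-zero     = λ x y p (e , _) → D4-zero x y p e
      ; D5-below    = λ i x y p (e , _) → D5-below i x y p e
      ; D5-last     = λ x y p (e , _) → D5-last x y p e
      }
    }
  }
  where open IsLayerDecomposition (LayerDecomposition.isLayerDecomposition D)

-- The first sequence sits inside the second one with offset m; all indices
-- i + m have to be in range.
EmbedsAt : ℕ → Layers n j → Layers n k → Set
EmbedsAt {k = k} m L₂ L₁ =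
  ∀ i → ∃[ i+m ] toℕ {suc k} i+m ≡ toℕ i + m ×
    T L₂ i ⊆ T L₁ i+m × S L₂ i ⊆ S L₁ i+m ×
    T L₂ i ─ S L₂ i ⊆ T L₁ i+m ─ S L₁ i+m

infix 4 _isSubPLDOf_

_isSubPLDOf_ : {G : DAG n} → PLD G → PLD G → Set
D′ isSubPLDOf D =
  Vars D′ ⊆ Vars D × ∃[ m ] EmbedsAt m (layers D′) (layers D)

record Insertion {G : DAG n} (x : Fin n) (D D′ : PLD G) : Set where
  field
    x∈V    : x ∈ vertices G
    x∉Vars : x ∉ Vars D
    Vars≡  : Vars D′ ≡ Vars D ∪ ⁅ x ⁆
    subPLD : D isSubPLDOf D′

Completes : {G : DAG n} → LayerDecomposition G → PLD G → Set
Completes D″ D′ = D′ isSubPLDOf toPLD D″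

data OptimalWidth {G : DAG n} (D′ : PLD G) : ℕ ⁺ → Set where
  attained : ∀ D″ → Completes D″ D′ →
             (∀ E → Completes E D′ → width D″ ≤ width E) →
             OptimalWidth D′ [ width D″ ]⁺
  none     : (∀ D″ → ¬ Completes D″ D′) → OptimalWidth D′ ⊤⁺

-- The remainder shows, by exhaustive search, that every PLD has an optimal
-- width in ℕ ∪ {∞}; w then picks it out.

isLayerDecomposition? : (G : DAG n) (L : Layers n k) → Dec (IsLayerDecomposition G L)
isLayerDecomposition? {n} {k} G L = map′
  (λ (a , b , c , d , e , f , g , h , p , q) → record
    { D1-nonempty = a ; D1-disjoint = b ; D1-⊆ = c ; D1-cover = d ; D2 = e
    ; D3 = f ; D4-suc = g ; D4-zero = h ; D5-below = p ; D5-last = q })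
  (λ d → let open IsLayerDecomposition d in
    D1-nonempty , D1-disjoint , D1-⊆ , D1-cover , D2
    , D3 , D4-suc , D4-zero , D5-below , D5-last)
  ( all? (λ i → nonempty? (T L i))
  ×-dec all? (λ i → all? λ j → all? λ x →
          (x ∈? T L i) →-dec ((x ∈? T L j) →-dec (i ≟ᶠ j)))
  ×-dec all? (λ i → T L i ⊆? vertices G)
  ×-dec all? (λ x → (x ∈? vertices G) →-dec any? (λ i → x ∈? T L i))
  ×-dec all? (λ i → S L i ⊆? T L i)
  ×-dec all? (λ i → all? λ x → all? λ y →
          (any? (λ h → (h <ᶠ? inject₁ i) ×-dec (x ∈? T L h)) ⊎-dec
            (x ∈? (T L (inject₁ i) ─ S L (inject₁ i)))) →-dec
          (any? (λ j → (inject₁ i <ᶠ? j) ×-dec (y ∈? T L j)) →-dec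
          ¬? ((x ⟶? y) ⊎-dec (y ⟶? x))))
  ×-dec all? (λ i → all? λ x → all? λ y → (x ∈? S L (suc i)) →-dec
          ((x ⟶? y) →-dec (y ∈? ((T L (suc i) ─ S L (suc i)) ∪ S L (inject₁ i)))))
  ×-dec all? (λ x → all? λ y → (x ∈? S L zero) →-dec
          ((x ⟶? y) →-dec (y ∈? (T L zero ─ S L zero))))
  ×-dec all? (λ i → all? λ x → all? λ y → (x ∈? S L (inject₁ i)) →-dec
          ((y ⟶? x) →-dec (y ∈? T L (suc i))))
  ×-dec all? (λ x → all? λ y → (x ∈? S L (fromℕ k)) →-dec ¬? (y ⟶? x)))
  where open DAG G using (_⟶?_)

embeds? : (L₂ : Layers n j) (L₁ : Layers n k) → Dec (∃[ m ] EmbedsAt m L₂ L₁)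
embeds? {n} {j} {k} L₂ L₁ = map′
  (λ (m , e) → toℕ m , e)
  (λ (m , e) → let m< = bound e in
    fromℕ< m< , subst (λ m → EmbedsAt m L₂ L₁) (sym (toℕ-fromℕ< m<)) e)
  (any? {n = suc k} λ m → all? λ i → any? λ i+m →
    (toℕ i+m ≟ᴺ toℕ i + toℕ m) ×-dec (T L₂ i ⊆? T L₁ i+m)
    ×-dec (S L₂ i ⊆? S L₁ i+m)
    ×-dec ((T L₂ i ─ S L₂ i) ⊆? (T L₁ i+m ─ S L₁ i+m)))
  where
  bound : ∀ {m} → EmbedsAt m L₂ L₁ → m < suc k
  bound e = let (i+m , eq , _) = e zero in
    subst (_< suc k) eq (toℕ<n i+m)

anyVec? : ∀ m {P : Vec (Subset n × Subset n) m → Set} → U.Decidable P → Dec (∃ P)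
anyVec? zero    P? = map′ ([] ,_) (λ { ([] , p) → p }) (P? [])
anyVec? (suc m) P? = map′
  (λ (t , s , L , p) → (t , s) ∷ L , p)
  (λ { ((t , s) ∷ L , p) → t , s , L , p })
  (anySubset? λ t → anySubset? λ s → anyVec? m λ L → P? ((t , s) ∷ L))

-- The blocks are nonempty and disjoint, so there are at most n of them.
last< : {G : DAG n} (D : LayerDecomposition G) → LayerDecomposition.last D < n
last< D = injective⇒≤ {f = λ i → proj₁ (D1-nonempty i)}
  λ {i} {j} eq → D1-disjoint i j _ (proj₂ (D1-nonempty i))
    (subst (_∈ T (LayerDecomposition.layers D) j) (sym eq) (proj₂ (D1-nonempty j)))
  where open IsLayerDecomposition (LayerDecomposition.isLayerDecomposition D)

anyDecomposition? : (G : DAG n) {P : ∀ {k} → Layers n k → Set} →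
                    (∀ {k} (L : Layers n k) → Dec (P L)) →
                    Dec (∃[ D ] P (LayerDecomposition.layers {G = G} D))
anyDecomposition? {n} G {P} P? = map′
  (λ (k , L , d , p) → record { layers = L ; isLayerDecomposition = d } , p)
  (λ (D , p) → let open LayerDecomposition D using (isLayerDecomposition) in
    fromℕ< (last< D) ,
    subst (λ k → ∃[ L ] IsLayerDecomposition {k = k} G L × P L)
          (sym (toℕ-fromℕ< (last< D)))
          (_ , isLayerDecomposition , p))
  (any? {n = n} λ k → anyVec? (suc (toℕ k)) λ L → isLayerDecomposition? G L ×-dec P? L)

module _ {G : DAG n} (D′ : PLD G) where

  private
    Fits : Layers n k → Set
    Fits L = Vars D′ ⊆ vertices G × ∃[ m ] EmbedsAt m (layers D′) L

    fits? : (L : Layers n k) → Dec (Fits L)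
    fits? L = (Vars D′ ⊆? vertices G) ×-dec embeds? (layers D′) L

    improve : ∀ D″ → Completes D″ D′ → Acc _<_ (width D″) → ∃ (OptimalWidth D′)
    improve D″ c (acc rs)
      with anyDecomposition? G {P = λ L → Fits L × maxSize L < width D″}
             (λ L → fits? L ×-dec (maxSize L <? width D″))
    ... | yes (E , c′ , E<D″) = improve E c′ (rs E<D″)
    ... | no ¬better          =
      [ width D″ ]⁺ , attained D″ c (λ E c′ → ≮⇒≥ (λ E<D″ → ¬better (E , c′ , E<D″)))

  optimalWidth : ∃ (OptimalWidth D′)
  optimalWidth with anyDecomposition? G {P = Fits} fits?
  ... | yes (D″ , c) = improve D″ c (<-wellFounded (width D″))
  ... | no ¬c        = ⊤⁺ , none (λ D″ c → ¬c (D″ , c))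

  w : ℕ ⁺
  w = proj₁ optimalWidth

{-# OPTIONS --safe #-}

-- A layer decomposition is the same as an ordered partition with subsets Sⁱ ⊆ Tⁱ
-- such that every arrow x ⟶ y with x ∈ Tⁱ has y ∈ Tⁱ ∖ Sⁱ or y ∈ Sⁱ⁻¹.  So the
-- layer of x is determined by the position of any child of x.  A root in the
-- boundary of Vars(D) has a child in Vars(D), hence all insertions put it into the
-- same layer and differ only in whether it belongs to S there.  As it has no
-- parents, that choice can be reversed in any completion, without changing the
-- blocks Tⁱ and hence the width.
module Submission where

open import Defs
open import Data.Fin using (Fin; zero; suc; inject₁; fromℕ; toℕ) renaming (_<_ to _<ᶠ_)
open import Data.Fin.Properties
  using (<-cmp; toℕ-injective; toℕ-inject₁; toℕ-fromℕ; toℕ<n) renaming (_≟_ to _≟ᶠ_)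
open import Data.Fin.Relation.Unary.Top using (view; ‵fromℕ; ‵inject₁)
open import Data.Fin.Subset using (Subset; _∈_; _∉_; _⊆_; _∪_; _∩_; _─_; _-_; ⁅_⁆; inside; outside)
open import Data.Fin.Subset.Properties
  using (_∈?_; x∈⁅x⁆; x∈⁅y⁆⇒x≡y; x∈p∧x∉q⇒x∈p─q; x∈p∧x≢y⇒x∈p-y; p─q⊆p; x∈p∪q⁻; x∈p∪q⁺; x∈p∩q⁺; x∈p∩q⁻)
open import Data.Nat using (ℕ; suc; _+_; _≤_; _<_; s≤s⁻¹; _⊔_)
open import Data.Nat.Properties
  using (<-irrefl; <-trans; <-asym; ≤-antisym; m+n≡0⇒n≡0; +-identityʳ; <⇒≱; suc-injective; ≤-reflexive; <⇒≢)
open import Data.Product using (∃-syntax; _×_; _,_; proj₁; proj₂)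
open import Data.Sum using (_⊎_; inj₁; inj₂; [_,_])
open import Data.Vec using (Vec; []; _∷_; map; there)
open import Data.Vec.Properties using (lookup-map)
open import Function using (_∘_)
open import Relation.Binary using (tri<; tri≈; tri>)
open import Relation.Binary.PropositionalEquality
  using (_≡_; _≢_; refl; sym; trans; cong; subst)
open import Relation.Nullary using (¬_; yes; no; contradiction)
open import Relation.Nullary.Construct.Add.Supremum using (_⁺) renaming ([_] to [_]⁺)

open DAG using (vertices)
open LayerDecomposition using (width)
open PLD using (Vars; layers)

private
  variable
    n k : ℕ
    G : DAG n

-- Layer decompositions as compatibility of arrows with layers

x∈p─q⇒x∉q : ∀ {x : Fin n} (p q : Subset n) → x ∈ p ─ q → x ∉ q
x∈p─q⇒x∉q (_ ∷ p) (inside ∷ q)  (there x∈) (there x∈q) = x∈p─q⇒x∉q p q x∈ x∈q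
x∈p─q⇒x∉q (_ ∷ p) (outside ∷ q) (there x∈) (there x∈q) = x∈p─q⇒x∉q p q x∈ x∈q

R : Layers n k → Fin (suc k) → Subset n
R L i = T L i ─ S L i

R⊆T : (L : Layers n k) → ∀ i → R L i ⊆ T L i
R⊆T L i = p─q⊆p (T L i) (S L i)

R∌S : (L : Layers n k) → ∀ i {x} → x ∈ R L i → x ∉ S L i
R∌S L i = x∈p─q⇒x∉q (T L i) (S L i)

-- Comparing layer numbers instead of `Fin` indices lets one formula cover layer 0, below which
-- there is no j, and the last layer, above which there is no i.
Compatible : Layers n k → Fin n → Fin n → Set
Compatible L x y =
  ∃[ i ] x ∈ T L i × (y ∈ R L i ⊎ ∃[ j ] suc (toℕ j) ≡ toℕ i × y ∈ S L j)

module _ {L : Layers n k} (d : IsLayerDecomposition G L) where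
  open DAG G using (_⟶_; source; target)
  open IsLayerDecomposition d

  -- D3 speaks of non-last layers only; this costs nothing, as no j lies above the last index.
  separated : ∀ {i j x y} → i <ᶠ j → x ∈ R L i → y ∈ T L j → ¬ (x ⟶ y ⊎ y ⟶ x)
  separated {i} {j} i<j x∈R y∈T with view i
  ... | ‵fromℕ     = contradiction (s≤s⁻¹ (toℕ<n j)) (<⇒≱ (subst (_< toℕ j) (toℕ-fromℕ k) i<j))
  ... | ‵inject₁ i = D3 i _ _ (inj₂ x∈R) (_ , i<j , y∈T)

  ⟶⇒compatible : ∀ {x y} → x ⟶ y → Compatible L x y
  ⟶⇒compatible {x} {y} e
    with D1-cover x (source e) | D1-cover y (target e)
  ... | i , x∈Ti | j , y∈Tj with y ∈? S L j | x ∈? S L i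
  ... | yes y∈S | _ = child-in-S j y∈S
    where
    child-in-S : ∀ j → y ∈ S L j → Compatible L x y
    child-in-S j y∈S with view j
    ... | ‵fromℕ     = contradiction e (D5-last y x y∈S)
    ... | ‵inject₁ j′ =
      suc j′ , D5-below j′ y x y∈S e , inj₂ (_ , cong suc (toℕ-inject₁ j′) , y∈S)
  ... | no _ | yes x∈S = parent-in-S i x∈S
    where
    parent-in-S : ∀ i → x ∈ S L i → Compatible L x y
    parent-in-S zero    x∈S = zero , D2 zero x∈S , inj₁ (D4-zero x y x∈S e)
    parent-in-S (suc i) x∈S with x∈p∪q⁻ _ _ (D4-suc i x y x∈S e)
    ... | inj₁ y∈R = suc i , D2 _ x∈S , inj₁ y∈R
    ... | inj₂ y∈S = suc i , D2 _ x∈S , inj₂ (_ , cong suc (toℕ-inject₁ i) , y∈S)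
  -- Neither end lies in its `S`, so D3 excludes distinct layers, whichever of the two is lower.
  ... | no y∉S | no x∉S with <-cmp i j
  ... | tri≈ _ refl _ = i , x∈Ti , inj₁ (x∈p∧x∉q⇒x∈p─q y∈Tj y∉S)
  ... | tri< i<j _ _ = contradiction (inj₁ e) (separated i<j (x∈p∧x∉q⇒x∈p─q x∈Ti x∉S) y∈Tj)
  ... | tri> _ _ j<i = contradiction (inj₂ e) (separated j<i (x∈p∧x∉q⇒x∈p─q y∈Tj y∉S) x∈Ti)

module _ (G : DAG n) (L : Layers n k) where
  open DAG G using (_⟶_)

  compatible⇒isLayerDecomposition :
    (∀ i → ∃[ x ] x ∈ T L i) →
    (∀ i j x → x ∈ T L i → x ∈ T L j → i ≡ j) →
    (∀ i → T L i ⊆ vertices G) →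
    (∀ x → x ∈ vertices G → ∃[ i ] x ∈ T L i) →
    (∀ i → S L i ⊆ T L i) →
    (∀ {x y} → x ⟶ y → Compatible L x y) →
    IsLayerDecomposition G L
  compatible⇒isLayerDecomposition nonempty disjoint T⊆V cover S⊆T compatible = record
    { D1-nonempty = nonempty
    ; D1-disjoint = disjoint
    ; D1-⊆        = T⊆V
    ; D1-cover    = cover
    ; D2          = S⊆T
    ; D3          = λ where
        i x y (inj₁ (h , h<i , x∈T)) (j , i<j , y∈T) →
          apart h j (<-trans h<i i<j) x∈T y∈T
            -- Since i lies strictly between h and j, the number of j exceeds that of h by at least
            -- 2.
            λ _ sh≡j → <⇒≱ h<i (s≤s⁻¹ (subst (_ <_) (sym sh≡j) i<j))
        i x y (inj₂ x∈R) (j , i<j , y∈T) →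
          apart (inject₁ i) j i<j (R⊆T L _ x∈R) y∈T λ x∈S _ → R∌S L _ x∈R x∈S
    ; D4-suc      = D4-suc
    ; D4-zero     = D4-zero
    ; D5-below    = D5-below
    ; D5-last     = D5-last
    }
    where
    -- Compatibility lets an arrow join layers h < j only by running down from layer j into `S L h`
    -- with j = h + 1; the last hypothesis rules that out.
    apart : ∀ h j {x y} → h <ᶠ j → x ∈ T L h → y ∈ T L j →
            (x ∈ S L h → suc (toℕ h) ≢ toℕ j) → ¬ (x ⟶ y ⊎ y ⟶ x)
    apart h j h<j x∈T y∈T _ (inj₁ e) with compatible e
    ... | i , x∈Ti , rest with disjoint _ _ _ x∈T x∈Ti
    ... | refl with rest
    ... | inj₁ y∈R = <⇒≢ h<j (cong toℕ (disjoint _ _ _ (R⊆T L _ y∈R) y∈T))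
    ... | inj₂ (j′ , sj≡h , y∈S) with disjoint _ _ _ (S⊆T _ y∈S) y∈T
    ... | refl = <-asym h<j (≤-reflexive sj≡h)
    apart h j h<j x∈T y∈T no-S (inj₂ e) with compatible e
    ... | i , y∈Ti , rest with disjoint _ _ _ y∈T y∈Ti
    ... | refl with rest
    ... | inj₁ x∈R = <⇒≢ h<j (cong toℕ (disjoint _ _ _ x∈T (R⊆T L _ x∈R)))
    ... | inj₂ (h′ , sh≡j , x∈S) with disjoint _ _ _ (S⊆T _ x∈S) x∈T
    ... | refl = no-S x∈S sh≡j

    D4-suc : ∀ i x y → x ∈ S L (suc i) → x ⟶ y → y ∈ R L (suc i) ∪ S L (inject₁ i)
    D4-suc i x y x∈S e with compatible e
    ... | i′ , x∈T , rest with disjoint _ _ _ (S⊆T _ x∈S) x∈T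
    ... | refl with rest
    ... | inj₁ y∈R = x∈p∪q⁺ (inj₁ y∈R)
    ... | inj₂ (j , sj≡si , y∈S) = x∈p∪q⁺ (inj₂ (subst (λ h → y ∈ S L h)
            (toℕ-injective (trans (suc-injective sj≡si) (sym (toℕ-inject₁ i)))) y∈S))

    D4-zero : ∀ x y → x ∈ S L zero → x ⟶ y → y ∈ R L zero
    D4-zero x y x∈S e with compatible e
    ... | i′ , x∈T , rest with disjoint _ _ _ (S⊆T _ x∈S) x∈T
    ... | refl with rest
    -- The `inj₂` case is impossible: 0 is not a successor.
    ... | inj₁ y∈R = y∈R

    D5-below : ∀ i x y → x ∈ S L (inject₁ i) → y ⟶ x → y ∈ T L (suc i)
    D5-below i x y x∈S e with compatible e
    ... | i′ , y∈T , inj₁ x∈R with disjoint _ _ _ (S⊆T _ x∈S) (R⊆T L _ x∈R)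
    ... | refl = contradiction x∈S (R∌S L _ x∈R)
    D5-below i x y x∈S e | i′ , y∈T , inj₂ (j , sj≡i′ , x∈Sj)
      with disjoint _ _ _ (S⊆T _ x∈S) (S⊆T _ x∈Sj)
    ... | refl = subst (λ h → y ∈ T L h)
            (toℕ-injective (trans (sym sj≡i′) (cong suc (toℕ-inject₁ i)))) y∈T

    D5-last : ∀ x y → x ∈ S L (fromℕ k) → ¬ y ⟶ x
    D5-last x y x∈S e with compatible e
    ... | i′ , y∈T , inj₁ x∈R with disjoint _ _ _ (S⊆T _ x∈S) (R⊆T L _ x∈R)
    ... | refl = R∌S L _ x∈R x∈S
    D5-last x y x∈S e | i′ , y∈T , inj₂ (j , sj≡i′ , x∈Sj)
      with disjoint _ _ _ (S⊆T _ x∈S) (S⊆T _ x∈Sj)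
    -- The parent would need layer number k + 1, which is out of range.
    ... | refl = <-irrefl (trans (sym sj≡i′) (cong suc (toℕ-fromℕ k))) (toℕ<n i′)

-- Moving a root into or out of `S`

module Relabel (x : Fin n) (U : Subset n) where

  -- Intersecting with `t` adds x only to its own layer, so the same map can be applied to all
  -- layers without knowing where x lies.
  relabelS : Subset n → Subset n → Subset n
  relabelS t s = (s - x) ∪ (t ∩ (⁅ x ⁆ ∩ U))

  -- Reassigns x, in whichever layer it lies: it is put into S iff x ∈ U.
  relabel : ∀ {m} → Vec (Subset n × Subset n) m → Vec (Subset n × Subset n) m
  relabel = map λ (t , s) → t , relabelS t s

  maxSize-relabel : ∀ {m} (L : Vec (Subset n × Subset n) m) → maxSize (relabel L) ≡ maxSize L
  maxSize-relabel []      = refl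
  maxSize-relabel (l ∷ L) = cong (_ ⊔_) (maxSize-relabel L)

  T-relabel : (L : Layers n k) → ∀ i → T (relabel L) i ≡ T L i
  T-relabel L i = cong proj₁ (lookup-map i _ L)

  S-relabel : (L : Layers n k) → ∀ i → S (relabel L) i ≡ relabelS (T L i) (S L i)
  S-relabel L i = cong proj₂ (lookup-map i _ L)

  module _ (L : Layers n k) (i : Fin (suc k)) where

    T⁺ : T L i ⊆ T (relabel L) i
    T⁺ = subst (_ ∈_) (sym (T-relabel L i))

    T⁻ : T (relabel L) i ⊆ T L i
    T⁻ = subst (_ ∈_) (T-relabel L i)

    S⁻ : ∀ {z} → z ∈ S (relabel L) i →
         (z ≢ x × z ∈ S L i) ⊎ (z ≡ x × x ∈ T L i × x ∈ U)
    S⁻ z∈ with x∈p∪q⁻ _ _ (subst (_ ∈_) (S-relabel L i) z∈)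
    ... | inj₁ z∈S-x = inj₁
      ( (λ { refl → x∈p─q⇒x∉q _ ⁅ x ⁆ z∈S-x (x∈⁅x⁆ x) })
      , p─q⊆p _ ⁅ x ⁆ z∈S-x )
    ... | inj₂ z∈∩ with x∈p∩q⁻ _ _ z∈∩
    ... | z∈T , z∈xU with x∈p∩q⁻ _ _ z∈xU
    ... | z∈x , z∈U with x∈⁅y⁆⇒x≡y _ z∈x
    ... | refl = inj₂ (refl , z∈T , z∈U)

    S-other⁺ : ∀ {z} → z ≢ x → z ∈ S L i → z ∈ S (relabel L) i
    S-other⁺ z≢x z∈S = subst (_ ∈_) (sym (S-relabel L i))
      (x∈p∪q⁺ (inj₁ (x∈p∧x≢y⇒x∈p-y z∈S z≢x)))

    S-self⁺ : x ∈ T L i → x ∈ U → x ∈ S (relabel L) i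
    S-self⁺ x∈T x∈U = subst (_ ∈_) (sym (S-relabel L i))
      (x∈p∪q⁺ (inj₂ (x∈p∩q⁺ (x∈T , x∈p∩q⁺ (x∈⁅x⁆ x , x∈U)))))

    R-other⁺ : ∀ {z} → z ≢ x → z ∈ R L i → z ∈ R (relabel L) i
    R-other⁺ z≢x z∈R = x∈p∧x∉q⇒x∈p─q (T⁺ (R⊆T L i z∈R))
      ([ R∌S L i z∈R ∘ proj₂ , z≢x ∘ proj₁ ] ∘ S⁻)

    R-self⁺ : x ∈ T L i → x ∉ U → x ∈ R (relabel L) i
    R-self⁺ x∈T x∉U = x∈p∧x∉q⇒x∈p─q (T⁺ x∈T)
      ([ (λ (x≢x , _) → x≢x refl) , (λ (_ , _ , x∈U) → x∉U x∈U) ] ∘ S⁻)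

  -- `Compatible` asks only of the child whether it lies in `S`. A root is never a child, so its own
  -- status is free.
  relabel-isLayerDecomposition : Root G x → {L : Layers n k} →
    IsLayerDecomposition G L → IsLayerDecomposition G (relabel L)
  relabel-isLayerDecomposition {G = G} (_ , no-parent) {L} d =
    compatible⇒isLayerDecomposition G (relabel L)
      (λ i → let (z , z∈T) = D1-nonempty i in z , T⁺ L i z∈T)
      (λ i j z z∈Ti z∈Tj → D1-disjoint i j z (T⁻ L i z∈Ti) (T⁻ L j z∈Tj))
      (λ i → D1-⊆ i ∘ T⁻ L i)
      (λ z z∈V → let (i , z∈T) = D1-cover z z∈V in i , T⁺ L i z∈T)
      S⊆T
      compatible
    where
    open DAG G using (_⟶_)
    open IsLayerDecomposition d

    S⊆T : ∀ i → S (relabel L) i ⊆ T (relabel L) i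
    S⊆T i z∈S with S⁻ L i z∈S
    ... | inj₁ (_ , z∈S)        = T⁺ L i (D2 i z∈S)
    ... | inj₂ (refl , x∈T , _) = T⁺ L i x∈T

    compatible : ∀ {y z} → y ⟶ z → Compatible (relabel L) y z
    compatible {y} {z} e = relabelled (⟶⇒compatible d e)
      where
      z≢x : z ≢ x
      z≢x refl = no-parent y e

      relabelled : Compatible L y z → Compatible (relabel L) y z
      relabelled (i , y∈T , inj₁ z∈R) = i , T⁺ L i y∈T , inj₁ (R-other⁺ L i z≢x z∈R)
      relabelled (i , y∈T , inj₂ (j , eq , z∈S)) =
        i , T⁺ L i y∈T , inj₂ (j , eq , S-other⁺ L j z≢x z∈S)

-- The layer of an inserted root

decomposed : (D : PLD G) → IsLayerDecomposition (G [ Vars D ]) (layers D)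
decomposed D = LayerDecomposition.isLayerDecomposition (PLD.decomposition D)

module _ {D : PLD G} {x : Fin n} {D′ : PLD G} (ins : Insertion x D D′) where
  open Insertion ins
  open IsLayerDecomposition (decomposed D′)
  private
    module D = IsLayerDecomposition (decomposed D)

  ∈Vars⁻ : ∀ {z} → z ∈ Vars D′ → z ∈ Vars D ⊎ z ≡ x
  ∈Vars⁻ z∈ with x∈p∪q⁻ _ _ (subst (_ ∈_) Vars≡ z∈)
  ... | inj₁ z∈D = inj₁ z∈D
  ... | inj₂ z∈x = inj₂ (x∈⁅y⁆⇒x≡y _ z∈x)

  x∈Vars : x ∈ Vars D′
  x∈Vars = subst (_ ∈_) (sym Vars≡) (x∈p∪q⁺ (inj₂ (x∈⁅x⁆ x)))

  -- Layer 0 of D′ is nonempty, but the variables of D lie in layers ≥ m and so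
  -- does x by hypothesis.
  offset-zero : ∀ {m c} → EmbedsAt m (layers D) (layers D′) →
                ∃[ i ] toℕ i ≡ c + m × x ∈ T (layers D′) i → m ≡ 0
  offset-zero {m} {c} emb (i , i≡c+m , x∈T) with D1-nonempty zero
  ... | z , z∈T₀ with ∈Vars⁻ (D1-⊆ zero z∈T₀)
  ... | inj₂ refl with D1-disjoint _ _ _ z∈T₀ x∈T
  ... | refl = m+n≡0⇒n≡0 c (sym i≡c+m)
  offset-zero {m} {c} emb _ | z , z∈T₀ | inj₁ z∈D with D.D1-cover z z∈D
  ... | p , z∈Tp with emb p
  ... | i , i≡p+m , T⊆ , _ with D1-disjoint _ _ _ z∈T₀ (T⊆ z∈Tp)
  ... | refl = m+n≡0⇒n≡0 (toℕ p) (sym i≡p+m)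

module _ {L : Layers n k} (d : IsLayerDecomposition G L) where
  open IsLayerDecomposition d

  -- As blocks are disjoint, the child's position leaves one alternative of `Compatible`. This and
  -- `parent-of-S` locate an inserted root from a child already placed.
  parent-of-R : ∀ {x y q} → Compatible L x y → y ∈ R L q → x ∈ T L q
  parent-of-R {q = q} (i , x∈T , inj₁ y∈R′) y∈R =
    subst (λ i → _ ∈ T L i) (D1-disjoint _ _ _ (R⊆T L _ y∈R′) (R⊆T L _ y∈R)) x∈T
  parent-of-R (i , x∈T , inj₂ (j , _ , y∈S)) y∈R
    with D1-disjoint _ _ _ (D2 _ y∈S) (R⊆T L _ y∈R)
  ... | refl = contradiction y∈S (R∌S L _ y∈R)

  parent-of-S : ∀ {x y q} → Compatible L x y → y ∈ S L q →
                ∃[ i ] toℕ i ≡ suc (toℕ q) × x ∈ T L i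
  parent-of-S (i , x∈T , inj₁ y∈R) y∈S
    with D1-disjoint _ _ _ (D2 _ y∈S) (R⊆T L _ y∈R)
  ... | refl = contradiction y∈S (R∌S L _ y∈R)
  parent-of-S (i , x∈T , inj₂ (j , sj≡i , y∈S′)) y∈S
    with D1-disjoint _ _ _ (D2 _ y∈S) (D2 _ y∈S′)
  ... | refl = i , sym sj≡i , x∈T

-- The layer of x is recorded as a natural number, since the index type varies with the insertion.
Anchored : {G : DAG n} → PLD G → Fin n → ℕ → PLD G → Set
Anchored D x c D′ =
  EmbedsAt 0 (layers D) (layers D′) × ∃[ i ] toℕ i ≡ c × x ∈ T (layers D′) i

module _ {G : DAG n} {D : PLD G} {x : Fin n} where
  open DAG G using (_⟶_)

  -- A position of x relative to the offset forces the offset to be 0, so the position becomes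
  -- absolute.
  anchored : ∀ c →
    (∀ D′ m → Insertion x D D′ → EmbedsAt m (layers D) (layers D′) →
      ∃[ i ] toℕ i ≡ c + m × x ∈ T (layers D′) i) →
    ∀ {D′} → Insertion x D D′ → Anchored D x c D′
  anchored c level {D′} ins with Insertion.subPLD ins
  ... | _ , m , emb with level D′ m ins emb
  ... | i , i≡c+m , x∈T with offset-zero ins {c = c} emb (i , i≡c+m , x∈T)
  ... | refl = emb , i , trans i≡c+m (+-identityʳ c) , x∈T

  -- The number c is read off from a child's place in D alone, before any insertion is given;
  -- embeddings keep the child's status and shift only layer numbers.
  insertions-anchored : Root G x → Boundary G (Vars D) x →
    ∃[ c ] ∀ {D′} → Insertion x D D′ → Anchored D x c D′
  insertions-anchored (_ , no-parent) (_ , _ , y , _ , inj₁ y⟶x) =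
    contradiction y⟶x (no-parent y)
  insertions-anchored _ (_ , _ , y , y∈D , inj₂ x⟶y) =
    let (p , y∈T) = D1-cover y y∈D in from-child p y∈T
    where
    open IsLayerDecomposition (decomposed D)

    compatible : ∀ D′ → Insertion x D D′ → Compatible (layers D′) x y
    compatible D′ ins = ⟶⇒compatible (decomposed D′)
      (x⟶y , x∈Vars ins , proj₁ (Insertion.subPLD ins) y∈D)

    from-child : ∀ p → y ∈ T (layers D) p → ∃[ c ] ∀ {D′} → Insertion x D D′ → Anchored D x c D′
    from-child p y∈T with y ∈? S (layers D) p
    -- A child in `S` sits one layer below its parent, any other child in the same layer.
    ... | yes y∈S = suc (toℕ p) , anchored _ λ D′ m ins emb →
      let (q , q≡p+m , _ , S⊆ , _) = emb p
          (i , i≡sq , x∈T) = parent-of-S (decomposed D′) (compatible D′ ins) (S⊆ y∈S)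
      in i , trans i≡sq (cong suc q≡p+m) , x∈T
    ... | no y∉S = toℕ p , anchored _ λ D′ m ins emb →
      let (q , q≡p+m , _ , _ , R⊆) = emb p
      in q , q≡p+m , parent-of-R (decomposed D′) (compatible D′ ins) (R⊆ (x∈p∧x∉q⇒x∈p─q y∈T y∉S))

  -- Transferring completions and comparing widths

  module _ (root : Root G x) {c : ℕ} {D₁ D₂ : PLD G}
           (ins₂ : Insertion x D D₂) (ins₁ : Insertion x D D₁)
           (anc₂ : Anchored D x c D₂) (anc₁ : Anchored D x c D₁) where
    private
      module D  = IsLayerDecomposition (decomposed D)
      module D₂ = IsLayerDecomposition (decomposed D₂)
      L₁ = layers D₁
      L₂ = layers D₂
      px : Fin (suc (PLD.last D₂))
      px = proj₁ (proj₂ anc₂)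
      x∈Tpx : x ∈ T L₂ px
      x∈Tpx = proj₂ (proj₂ (proj₂ anc₂))

    -- With this choice of U, relabelling gives x the status it has in `D₂`.
    open Relabel x (S L₂ px)

    -- Variables of D inherit layer number and status from D in both insertions, as both offsets are
    -- 0; x has layer c in both, but its status may differ, hence `z ≢ x`.
    aligned : ∀ {z} i → z ∈ T L₂ i → ∃[ i₁ ] toℕ i₁ ≡ toℕ i × z ∈ T L₁ i₁ ×
      (z ≢ x → (z ∈ S L₂ i → z ∈ S L₁ i₁) × (z ∈ R L₂ i → z ∈ R L₁ i₁))
    aligned {z} i z∈T with ∈Vars⁻ ins₂ (D₂.D1-⊆ i z∈T)
    ... | inj₂ refl with proj₂ anc₁ | proj₂ anc₂
    ... | i₁ , i₁≡c , x∈T₁ | i₂ , i₂≡c , x∈T₂ with D₂.D1-disjoint _ _ _ z∈T x∈T₂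
    ... | refl = i₁ , trans i₁≡c (sym i₂≡c) , x∈T₁ , λ z≢z → contradiction refl z≢z
    aligned {z} i z∈T | inj₁ z∈D with D.D1-cover z z∈D
    ... | p , z∈Tp with proj₁ anc₁ p | proj₁ anc₂ p
    ... | i₁ , i₁≡ , T⊆₁ , S⊆₁ , R⊆₁ | i₂ , i₂≡ , T⊆₂ , S⊆₂ , R⊆₂
      with D₂.D1-disjoint _ _ _ z∈T (T⊆₂ z∈Tp)
    ... | refl = i₁ , trans i₁≡ (sym i₂≡) , T⊆₁ z∈Tp , λ _ → S⇒S , R⇒R
      where
      S⇒S : z ∈ S L₂ i → z ∈ S L₁ i₁
      S⇒S z∈S₂ with z ∈? S (layers D) p
      ... | yes z∈S = S⊆₁ z∈S
      ... | no  z∉S = contradiction z∈S₂ (R∌S L₂ i (R⊆₂ (x∈p∧x∉q⇒x∈p─q z∈Tp z∉S)))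
      R⇒R : z ∈ R L₂ i → z ∈ R L₁ i₁
      R⇒R z∈R₂ with z ∈? S (layers D) p
      ... | yes z∈S = contradiction (S⊆₂ z∈S) (R∌S L₂ i z∈R₂)
      ... | no  z∉S = R⊆₁ (x∈p∧x∉q⇒x∈p─q z∈Tp z∉S)

    relabel-embeds : ∀ {k m} (L : Layers n k) → EmbedsAt m L₁ L → EmbedsAt m L₂ (relabel L)
    -- `emb` needs an index of `L₁`; any variable of the nonempty layer i supplies one with the same
    -- number.
    relabel-embeds L emb i with D₂.D1-nonempty i
    ... | z₀ , z₀∈T with aligned i z₀∈T
    ... | i₁ , i₁≡i , _ with emb i₁
    ... | q , q≡i₁+m , T⊆ , S⊆ , R⊆ =
      q , trans q≡i₁+m (cong (_+ _) i₁≡i) , T⊆′ , S⊆′ , R⊆′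
      where
      aligned-i₁ : ∀ {z} → z ∈ T L₂ i → z ∈ T L₁ i₁ ×
        (z ≢ x → (z ∈ S L₂ i → z ∈ S L₁ i₁) × (z ∈ R L₂ i → z ∈ R L₁ i₁))
      aligned-i₁ z∈T with aligned i z∈T
      -- Equal numbers show that each variable of the layer yields the index found from `z₀`.
      ... | i₁′ , i₁′≡i , rest with toℕ-injective (trans i₁≡i (sym i₁′≡i))
      ... | refl = rest

      T⊆L : T L₂ i ⊆ T L q
      T⊆L z∈T = T⊆ (proj₁ (aligned-i₁ z∈T))

      T⊆′ : T L₂ i ⊆ T (relabel L) q
      T⊆′ = T⁺ L q ∘ T⊆L

      S⊆′ : S L₂ i ⊆ S (relabel L) q
      S⊆′ {z} z∈S with z ≟ᶠ x | D₂.D2 i z∈S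
      ... | no z≢x   | z∈T = S-other⁺ L q z≢x (S⊆ (proj₁ (proj₂ (aligned-i₁ z∈T) z≢x) z∈S))
      -- Here i is `px`, so `z∈S` says exactly that x belongs to U.
      ... | yes refl | z∈T with D₂.D1-disjoint _ _ _ z∈T x∈Tpx
      ... | refl = S-self⁺ L q (T⊆L z∈T) z∈S

      R⊆′ : R L₂ i ⊆ R (relabel L) q
      R⊆′ {z} z∈R with z ≟ᶠ x | R⊆T L₂ i z∈R
      ... | no z≢x   | z∈T = R-other⁺ L q z≢x (R⊆ (proj₂ (proj₂ (aligned-i₁ z∈T) z≢x) z∈R))
      ... | yes refl | z∈T with D₂.D1-disjoint _ _ _ z∈T x∈Tpx
      ... | refl = R-self⁺ L q (T⊆L z∈T) (R∌S L₂ i z∈R)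

    transfer : ∀ D″ → Completes D″ D₁ → ∃[ E ] Completes E D₂ × width E ≡ width D″
    transfer D″ (_ , m , emb) =
      record
        { layers               = relabel L
        ; isLayerDecomposition =
            relabel-isLayerDecomposition root (LayerDecomposition.isLayerDecomposition D″)
        }
      , (PLD.Vars⊆V D₂ , m , relabel-embeds L emb)
      , maxSize-relabel L
      where L = LayerDecomposition.layers D″

-- Each minimum bounds the other through a transferred completion of equal width, and one side is
-- infinite only if the other is.
optimalWidth-unique : {D₁ D₂ : PLD G} {v₁ v₂ : ℕ ⁺} →
  (∀ D″ → Completes D″ D₁ → ∃[ E ] Completes E D₂ × width E ≡ width D″) →
  (∀ D″ → Completes D″ D₂ → ∃[ E ] Completes E D₁ × width E ≡ width D″) →
  OptimalWidth D₁ v₁ → OptimalWidth D₂ v₂ → v₁ ≡ v₂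
optimalWidth-unique to from (attained A a A-min) (attained B b B-min)
  with to A a | from B b
... | B′ , b′ , B′≡A | A′ , a′ , A′≡B = cong [_]⁺ (≤-antisym
  (subst (_ ≤_) A′≡B (A-min A′ a′)) (subst (_ ≤_) B′≡A (B-min B′ b′)))
optimalWidth-unique to from (attained A a _) (none ¬b) =
  let (B , b , _) = to A a in contradiction b (¬b B)
optimalWidth-unique to from (none ¬a) (attained B b _) =
  let (A , a , _) = from B b in contradiction a (¬a A)
optimalWidth-unique to from (none _) (none _) = refl

theorem6 : ∀ (n : ℕ) (G : DAG n) (D : PLD G) (X : Fin n) →
    Root G X → Boundary G (PLD.Vars D) X →
    ∀ (D₁ D₂ : PLD G) → Insertion X D D₁ → Insertion X D D₂ →
    w D₁ ≡ w D₂
theorem6 n G D X root boundary D₁ D₂ ins₁ ins₂ =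
  let (_ , anchor) = insertions-anchored root boundary
  in optimalWidth-unique
       -- The same c anchors both insertions, so completions transfer in both directions.
       (transfer root ins₂ ins₁ (anchor ins₂) (anchor ins₁))
       (transfer root ins₁ ins₂ (anchor ins₁) (anchor ins₂))
       (proj₂ (optimalWidth D₁)) (proj₂ (optimalWidth D₂))
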